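{- Let $z$ be a complex number (or an indeterminate). For every integer $n\ge 0$, $$\sum_{\substack{\tilde\pi \in \mathcal{O}_4 \\ \sigma(\tilde\pi)=n}} z^{\nu(\tilde\pi)}(1-z^2)^{N_5(\tilde\pi)}=\sum_{\substack{\pi \in \mathcal{D}_{2,4} \\ \sigma(\pi)=n}} z^{\nu(\pi;1,2)}(-z^2)^{\nu(\pi;0,2)}.$$
   Context: $\mathcal{O}_4$ is the set of partitions into odd parts such that any two parts differ by at least $4$ (so parts are distinct). For $\tilde\pi\in\mathcal{O}_4$, a chain is a maximal string of consecutive parts of $\tilde\pi$ differing by exactly $4$ (a part differing by more than 4 from its neighbours forms a chain by itself); $N_\lambda(\tilde\pi)$ is the number of chains of $\tilde\pi$ whose least part is $\ge\lambda$. $\mathcal{D}_{2,4}$ is the set of partitions into distinct parts none of which is $\equiv 2 \pmod 4$. For a partition $\pi$: $\sigma(\pi)$ is the sum of its parts, $\nu(\pi)$ is its number of parts, and $\nu(\pi;r,m)$ is the number of its parts that are $\equiv r \pmod m$. -}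

module Defs where

open import Data.Nat using (ℕ; zero; suc; _+_; _≤ᵇ_; _≡ᵇ_; _%_; NonZero)
open import Data.Bool using (Bool; true; false; _∧_; not; if_then_else_)
open import Data.Nat.ListAction using (sum)
open import Data.List using (List; []; _∷_; map; filter; length; foldr; downFrom; _++_; last)
open import Data.Maybe using (Maybe; just; nothing)
open import Relation.Nullary.Decidable using (T?)
open import Algebra.Bundles using (CommutativeRing)
open import Level using (Level)

-- A partition into distinct parts is represented as a strictly decreasing
-- list of positive naturals (parts listed from largest to smallest).

sublists : List ℕ → List (List ℕ)
sublists [] = [] ∷ []
sublists (x ∷ xs) = map (x ∷_) (sublists xs) ++ sublists xs

σ : List ℕ → ℕ
σ = sum

distinctPartitions : ℕ → List (List ℕ)
distinctPartitions n = filter (λ p → T? (σ p ≡ᵇ n)) (sublists (map suc (downFrom n)))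

isOdd : ℕ → Bool
isOdd k = k % 2 ≡ᵇ 1

isO4 : List ℕ → Bool
isO4 [] = true
isO4 (x ∷ []) = isOdd x
isO4 (x ∷ y ∷ ys) = isOdd x ∧ ((y + 4) ≤ᵇ x) ∧ isO4 (y ∷ ys)

-- membership in 𝒟_{2,4} (distinct parts, already ensured): no part ≡ 2 mod 4
isD24 : List ℕ → Bool
isD24 [] = true
isD24 (x ∷ xs) = not (x % 4 ≡ᵇ 2) ∧ isD24 xs

chains : List ℕ → List (List ℕ)
chains [] = []
chains (x ∷ xs) with chains xs
... | [] = (x ∷ []) ∷ []
... | [] ∷ cs = (x ∷ []) ∷ [] ∷ cs
... | (y ∷ c) ∷ cs = if (y + 4) ≡ᵇ x then (x ∷ y ∷ c) ∷ cs else (x ∷ []) ∷ (y ∷ c) ∷ cs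

-- least part of a chain (chains are decreasing, so it is the last element)
leastPart : List ℕ → ℕ
leastPart c with last c
... | just m = m
... | nothing = 0

N : ℕ → List ℕ → ℕ
N λ' p = length (filter (λ c → T? (λ' ≤ᵇ leastPart c)) (chains p))

ν : List ℕ → ℕ
ν = length

νmod : List ℕ → ℕ → (m : ℕ) → .{{NonZero m}} → ℕ
νmod p r m = length (filter (λ k → T? ((k % m) ≡ᵇ r)) p)

module _ {c ℓ : Level} (R : CommutativeRing c ℓ) where
  open CommutativeRing R using (Carrier; 1#; 0#) renaming (_+_ to _+R_; _*_ to _*R_)

  pow : Carrier → ℕ → Carrier
  pow z zero = 1#
  pow z (suc k) = z *R pow z k

  Σ-list : {A : Set} → List A → (A → Carrier) → Carrier
  Σ-list xs f = foldr (λ a acc → f a +R acc) 0# xs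

{-# OPTIONS --safe #-}

-- Write a = −z².  The weighted generating function e (m+1) of the partitions in 𝒪₄ with parts
-- at most 2m satisfies e (k+3) = e (k+2) + z q^(2k+3) (e (k+1) + a e k), since prepending
-- a part x multiplies the weight by z if x − 4 is the largest part, and by z (1 + a) if the
-- largest part is smaller.  Let e′ be the sequence e with z replaced by z q².  Then, exactly,
--   e (k+2) + a z q^(2k+3) e k = (1 + z q) (e′ (k+1) + a q⁴ e′ k),
-- because both sides satisfy the same third-order recurrence and agree for k = 0, 1, 2.
-- Modulo high powers of q this reads e (k+2) = (1 + z q) (1 + a q⁴) e′ (k+1), and iterating
-- gives the product ∏ (1 + z q^(2i−1)) (1 − z² q^(4i)) that generates the right-hand side.
-- Coefficients up to qⁿ are compared in the ring of power series truncated after qⁿ.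
module Submission where

open import Defs
open import Data.Nat using (ℕ; zero; suc; _≤_; _<_; z≤n; s≤s; _≡ᵇ_; _≤ᵇ_; _≤?_; _≟_; _%_; _∸_)
  renaming (_+_ to _+ℕ_; _*_ to _*ℕ_)
open import Data.Nat.Properties
  using (≤-trans; ≤-refl; <⇒≤; <⇒≱; <⇒≢; n≤1+n; m≤n+m; m≤m*n; m∸n+n≡m)
  renaming (+-comm to +ℕ-comm; +-identityʳ to +ℕ-identityʳ; *-comm to *ℕ-comm; *-assoc to *ℕ-assoc)
open import Data.Nat.DivMod using ([m+kn]%n≡m%n)
open import Data.Bool using (Bool; true; false; if_then_else_)
open import Data.List using (List; []; _∷_; _++_; map; filter; length; downFrom; last)
open import Data.List.Relation.Unary.All as All using (All; []; _∷_)
import Data.List.Relation.Unary.All.Properties as AllP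
open import Data.Maybe using (just; nothing)
open import Data.Product using (∃₂; _,_)
open import Function using (_∘_)
open import Relation.Nullary.Decidable using (T?; dec-true; dec-false)
open import Relation.Binary.PropositionalEquality as ≡ using (_≡_)
open import Algebra.Bundles using (CommutativeRing)
open import Level using (Level)
import Algebra.Solver.Ring.NaturalCoefficients.Default as Solver
import Relation.Binary.Reasoning.Setoid as SetoidReasoning

-- The recurrence and its product solution, in any commutative ring with an element `q`.

module Recurrence {c ℓ} (S : CommutativeRing c ℓ) (q : CommutativeRing.Carrier S) where
  open CommutativeRing S
  open Solver commutativeSemiring
  open SetoidReasoning setoid

  q^ : ℕ → Carrier
  q^ = pow S q

  -- The value 0 at index 0 makes the part 3 enter with weight `z` alone: a chain with least part 3
  -- is not counted by `N 5`, so it earns no factor `1 + a`.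
  gapSeq : Carrier → Carrier → ℕ → Carrier
  gapSeq z a 0 = 0#
  gapSeq z a 1 = 1#
  gapSeq z a 2 = 1# + z * q^ 1
  gapSeq z a (suc (suc (suc k))) =
    gapSeq z a (suc (suc k)) + z * q^ (3 +ℕ k *ℕ 2) * (gapSeq z a (suc k) + a * gapSeq z a k)

  oddProduct : Carrier → ℕ → Carrier
  oddProduct z zero = 1#
  oddProduct z (suc m) = oddProduct z m * (1# + z * q^ (1 +ℕ m *ℕ 2))

  quadProduct : Carrier → ℕ → Carrier
  quadProduct a zero = 1#
  quadProduct a (suc m) = quadProduct a m * (1# + a * q^ (suc m *ℕ 4))

  private
    -- Polynomial form of `q^ (i +ℕ j)` with `w` standing for `q^ j`: that power unfolds
    -- definitionally to `i` factors `q` applied to `q^ j`, so the solver can treat a variable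
    -- exponent as an atom.
    Q : ∀ {n} → ℕ → Polynomial n → Polynomial n → Polynomial n
    Q zero q w = w
    Q (suc i) q w = q :* Q i q w

    Q₁ : ∀ {n} → ℕ → Polynomial n → Polynomial n
    Q₁ i q = Q i q (con 1)

  module _ (z a : Carrier) where
    z′ a′ : Carrier
    z′ = z * q^ 2
    a′ = a * q^ 4

    -- With y k = z q^(2k+3) and e, e′ the sequences for (z, a), (z′, a′), both functions
    -- satisfy u (k+3) = u (k+2) + y (k+2) (u (k+1) + a q² u k): the terms added to e (resp. e′)
    -- rescale the coefficient a of the recurrence by q² (resp. q⁻²).
    gauged gauged′ : ℕ → Carrier
    gauged k = gapSeq z a (2 +ℕ k) + a * (z * q^ (3 +ℕ k *ℕ 2)) * gapSeq z a k
    gauged′ k = (1# + z * q^ 1) * (gapSeq z′ a′ (suc k) + a′ * gapSeq z′ a′ k)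

    gauged-rec : ∀ k → gauged (3 +ℕ k) ≈
      gauged (2 +ℕ k) + z * q^ (7 +ℕ k *ℕ 2) * (gauged (1 +ℕ k) + a * q^ 2 * gauged k)
    gauged-rec k = solve 7 (λ z q a w e₀ e₁ e₂ →
        let e₃ = e₂ :+ z :* Q 3 q w :* (e₁ :+ a :* e₀)
            e₄ = e₃ :+ z :* Q 5 q w :* (e₂ :+ a :* e₁)
            e₅ = e₄ :+ z :* Q 7 q w :* (e₃ :+ a :* e₂)
            u = λ i e′ e → e′ :+ a :* (z :* Q i q w) :* e
        in u 9 e₅ e₃ := u 7 e₄ e₂ :+ z :* Q 7 q w :* (u 5 e₃ e₁ :+ a :* Q₁ 2 q :* u 3 e₂ e₀))
      refl z q a (q^ (k *ℕ 2)) (gapSeq z a k) (gapSeq z a (suc k)) (gapSeq z a (suc (suc k)))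

    gauged′-rec : ∀ k → gauged′ (3 +ℕ k) ≈
      gauged′ (2 +ℕ k) + z * q^ (7 +ℕ k *ℕ 2) * (gauged′ (1 +ℕ k) + a * q^ 2 * gauged′ k)
    gauged′-rec k = solve 7 (λ z q a w e₀ e₁ e₂ →
        let z′ = z :* Q₁ 2 q
            a′ = a :* Q₁ 4 q
            e₃ = e₂ :+ z′ :* Q 3 q w :* (e₁ :+ a′ :* e₀)
            e₄ = e₃ :+ z′ :* Q 5 q w :* (e₂ :+ a′ :* e₁)
            u = λ e′ e → (con 1 :+ z :* Q₁ 1 q) :* (e′ :+ a′ :* e)
        in u e₄ e₃ := u e₃ e₂ :+ z :* Q 7 q w :* (u e₂ e₁ :+ a :* Q₁ 2 q :* u e₁ e₀))
      refl z q a (q^ (k *ℕ 2)) (gapSeq z′ a′ k) (gapSeq z′ a′ (suc k)) (gapSeq z′ a′ (suc (suc k)))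

    -- Replacing `z` by `z q²` carries each factor to the next one, so splitting off the first
    -- factor leaves the product for `z′`.
    oddProduct-suc : ∀ m → oddProduct z (suc m) ≈ (1# + z * q^ 1) * oddProduct z′ m
    oddProduct-suc zero = *-comm _ _
    oddProduct-suc (suc m) = trans (*-congʳ (oddProduct-suc m))
      (solve 4 (λ z q w d →
          (con 1 :+ z :* Q₁ 1 q) :* d :* (con 1 :+ z :* Q 3 q w) :=
          (con 1 :+ z :* Q₁ 1 q) :* (d :* (con 1 :+ z :* Q₁ 2 q :* Q 1 q w)))
        refl z q (q^ (m *ℕ 2)) (oddProduct z′ m))

    quadProduct-suc : ∀ m → quadProduct a (suc m) ≈ (1# + a′) * quadProduct a′ m
    quadProduct-suc zero = *-comm _ _
    quadProduct-suc (suc m) = trans (*-congʳ (quadProduct-suc m))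
      (solve 4 (λ a q w d →
          (con 1 :+ a :* Q₁ 4 q) :* d :* (con 1 :+ a :* Q 8 q w) :=
          (con 1 :+ a :* Q₁ 4 q) :* (d :* (con 1 :+ a :* Q₁ 4 q :* Q 4 q w)))
        refl a q (q^ (m *ℕ 4)) (quadProduct a′ m))

    module _ (z²+a≈0 : z * z + a ≈ 0#) where
      -- Both terms gain the factor q⁴; this is what allows the identity for `z`, `a` to be iterated
      -- with `z′`, `a′`.
      z′²+a′≈0 : z′ * z′ + a′ ≈ 0#
      z′²+a′≈0 = begin
        z′ * z′ + a′ ≈⟨ solve 3 (λ z a q → z :* Q₁ 2 q :* (z :* Q₁ 2 q) :+ a :* Q₁ 4 q :=
                          (z :* z :+ a) :* Q₁ 4 q) refl z a q ⟩
        (z * z + a) * q^ 4 ≈⟨ *-congʳ z²+a≈0 ⟩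
        0# * q^ 4 ≈⟨ zeroˡ _ ⟩
        0# ∎

      private
        -- The initial values for k = 1, 2 agree only modulo `z * z + a`. The solver proves an
        -- identity with that multiple written out, and this removes it.
        cancel : ∀ {x y t} → x ≈ y + (z * z + a) * t → y ≈ x
        cancel {x} {y} {t} x≈ = begin
          y ≈⟨ +-identityʳ y ⟨
          y + 0# ≈⟨ +-congˡ (zeroˡ t) ⟨
          y + 0# * t ≈⟨ +-congˡ (*-congʳ z²+a≈0) ⟨
          y + (z * z + a) * t ≈⟨ x≈ ⟨
          x ∎

      gauged≈gauged′ : ∀ k → gauged k ≈ gauged′ k
      gauged≈gauged′ 0 = solve 3 (λ z a q →
          let e₂ = con 1 :+ z :* Q₁ 1 q
          in e₂ :+ a :* (z :* Q₁ 3 q) :* con 0 := e₂ :* (con 1 :+ a :* Q₁ 4 q :* con 0))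
        refl z a q
      gauged≈gauged′ 1 = cancel (solve 3 (λ z a q →
          let e₂ = con 1 :+ z :* Q₁ 1 q
              e₃ = e₂ :+ z :* Q₁ 3 q :* (con 1 :+ a :* con 0)
              e₂′ = con 1 :+ z :* Q₁ 2 q :* Q₁ 1 q
          in e₂ :* (e₂′ :+ a :* Q₁ 4 q :* con 1) :=
             e₃ :+ a :* (z :* Q₁ 5 q) :* con 1 :+ (z :* z :+ a) :* Q₁ 4 q)
        refl z a q)
      gauged≈gauged′ 2 = cancel (solve 3 (λ z a q →
          let e₂ = con 1 :+ z :* Q₁ 1 q
              e₃ = e₂ :+ z :* Q₁ 3 q :* (con 1 :+ a :* con 0)
              e₄ = e₃ :+ z :* Q₁ 5 q :* (e₂ :+ a :* con 1)
              z′ = z :* Q₁ 2 q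
              a′ = a :* Q₁ 4 q
              e₂′ = con 1 :+ z′ :* Q₁ 1 q
              e₃′ = e₂′ :+ z′ :* Q₁ 3 q :* (con 1 :+ a′ :* con 0)
          in e₂ :* (e₃′ :+ a′ :* e₂′) :=
             e₄ :+ a :* (z :* Q₁ 7 q) :* e₂ :+ (z :* z :+ a) :* Q₁ 4 q)
        refl z a q)
      gauged≈gauged′ (suc (suc (suc k))) = begin
        gauged (3 +ℕ k) ≈⟨ gauged-rec k ⟩
        gauged (2 +ℕ k) + z * q^ (7 +ℕ k *ℕ 2) * (gauged (1 +ℕ k) + a * q^ 2 * gauged k)
          ≈⟨ +-cong (gauged≈gauged′ (suc (suc k))) (*-congˡ (+-cong (gauged≈gauged′ (suc k))
               (*-congˡ (gauged≈gauged′ k)))) ⟩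
        gauged′ (2 +ℕ k) + z * q^ (7 +ℕ k *ℕ 2) * (gauged′ (1 +ℕ k) + a * q^ 2 * gauged′ k)
          ≈⟨ gauged′-rec k ⟨
        gauged′ (3 +ℕ k) ∎

  private
    x+0y≈x : ∀ {x d y} → d ≈ 0# → x + d * y ≈ x
    x+0y≈x {x} {d} {y} d≈0 = begin
      x + d * y ≈⟨ +-congˡ (*-congʳ d≈0) ⟩
      x + 0# * y ≈⟨ +-congˡ (zeroˡ y) ⟩
      x + 0# ≈⟨ +-identityʳ x ⟩
      x ∎

  gapSeq-stable : ∀ z a m → z * q^ (1 +ℕ m *ℕ 2) ≈ 0# → gapSeq z a (2 +ℕ m) ≈ gapSeq z a (1 +ℕ m)
  gapSeq-stable z a zero zq≈0 = trans (+-congˡ zq≈0) (+-identityʳ 1#)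
  gapSeq-stable z a (suc m) zq≈0 = x+0y≈x zq≈0

  -- Induction on `m` for all `z` and `a` at once: z′ q^(2m+1) = z q^(2m+3), so the vanishing
  -- hypothesis for `z` at `suc m` is the one for `z′` at `m`.
  gapSeq≈product : ∀ m z a → z * z + a ≈ 0# → z * q^ (1 +ℕ m *ℕ 2) ≈ 0# →
    gapSeq z a (2 +ℕ m) ≈ oddProduct z (suc m) * quadProduct a (suc m)
  gapSeq≈product zero z a z²+a≈0 zq≈0 = begin
    1# + z * q^ 1 ≈⟨ *-identityˡ _ ⟨
    1# * (1# + z * q^ 1) ≈⟨ *-identityʳ _ ⟨
    1# * (1# + z * q^ 1) * 1# ≈⟨ *-congˡ (trans (*-identityˡ _) (trans (+-congˡ aq⁴≈0) (+-identityʳ 1#))) ⟨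
    1# * (1# + z * q^ 1) * (1# * (1# + a * q^ 4)) ∎
    where
    -- The extra factor 1 + a q⁴ has to be 1. Since a = -z², the term a q⁴ is -(z q)(z q³), and z q
    -- vanishes.
    aq⁴≈0 : a * q^ 4 ≈ 0#
    aq⁴≈0 = begin
      a * q^ 4 ≈⟨ x+0y≈x zq≈0 ⟨
      a * q^ 4 + z * q^ 1 * (z * q^ 3)
        ≈⟨ solve 3 (λ z a q → a :* Q₁ 4 q :+ z :* Q₁ 1 q :* (z :* Q₁ 3 q) :=
             (z :* z :+ a) :* Q₁ 4 q) refl z a q ⟩
      (z * z + a) * q^ 4 ≈⟨ *-congʳ z²+a≈0 ⟩
      0# * q^ 4 ≈⟨ zeroˡ _ ⟩
      0# ∎
  gapSeq≈product (suc m) z a z²+a≈0 zq≈0 = begin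
    -- The second term of `gauged z a (1 +ℕ m)` is a multiple of z q^(2m+3), hence zero, and can be
    -- added.
    gapSeq z a (3 +ℕ m) ≈⟨ x+0y≈x zq≈0 ⟨
    gapSeq z a (3 +ℕ m) + z * q^ (3 +ℕ m *ℕ 2) * (a * q^ 2 * gapSeq z a (1 +ℕ m))
      ≈⟨ +-congˡ (solve 5 (λ z a q w e → z :* Q 3 q w :* (a :* Q₁ 2 q :* e) :=
           a :* (z :* Q 5 q w) :* e) refl z a q (q^ (m *ℕ 2)) _) ⟩
    gauged z a (1 +ℕ m) ≈⟨ gauged≈gauged′ z a z²+a≈0 (suc m) ⟩
    (1# + z * q^ 1) * (e (2 +ℕ m) + a′ z a * e (1 +ℕ m))
      -- The sequence `e` is already stationary here, so both terms contain the same value and the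
      -- factor 1 + a q⁴ comes out.
      ≈⟨ *-congˡ (+-congˡ (*-congˡ (gapSeq-stable (z′ z a) (a′ z a) m z′q≈0))) ⟨
    (1# + z * q^ 1) * (e (2 +ℕ m) + a′ z a * e (2 +ℕ m))
      ≈⟨ *-congˡ (+-cong e≈ (*-congˡ e≈)) ⟩
    (1# + z * q^ 1) * (D * C + a′ z a * (D * C))
      ≈⟨ solve 4 (λ x b d c → x :* (d :* c :+ b :* (d :* c)) :=
           x :* d :* ((con 1 :+ b) :* c)) refl (1# + z * q^ 1) (a′ z a) D C ⟩
    (1# + z * q^ 1) * D * ((1# + a′ z a) * C)
      ≈⟨ *-cong (oddProduct-suc z a (suc m)) (quadProduct-suc z a (suc m)) ⟨
    oddProduct z (2 +ℕ m) * quadProduct a (2 +ℕ m) ∎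
    where
    e : ℕ → Carrier
    e = gapSeq (z′ z a) (a′ z a)
    D C : Carrier
    D = oddProduct (z′ z a) (suc m)
    C = quadProduct (a′ z a) (suc m)
    z′q≈0 : z′ z a * q^ (1 +ℕ m *ℕ 2) ≈ 0#
    z′q≈0 = trans (solve 3 (λ z q w → z :* Q 2 q (con 1) :* Q 1 q w := z :* Q 3 q w)
      refl z q (q^ (m *ℕ 2))) zq≈0
    e≈ : e (2 +ℕ m) ≈ D * C
    e≈ = gapSeq≈product m (z′ z a) (a′ z a) (z′²+a′≈0 z a z²+a≈0) z′q≈0

  quadProduct-stable : ∀ a m j → (∀ i → a * q^ ((suc i +ℕ m) *ℕ 4) ≈ 0#) →
    quadProduct a (j +ℕ m) ≈ quadProduct a m
  quadProduct-stable a m zero _ = refl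
  quadProduct-stable a m (suc j) aq≈0 = begin
    quadProduct a (j +ℕ m) * (1# + a * q^ (suc (j +ℕ m) *ℕ 4))
      ≈⟨ *-congˡ (trans (+-congˡ (aq≈0 j)) (+-identityʳ 1#)) ⟩
    quadProduct a (j +ℕ m) * 1# ≈⟨ *-identityʳ _ ⟩
    quadProduct a (j +ℕ m) ≈⟨ quadProduct-stable a m j aq≈0 ⟩
    quadProduct a m ∎

-- Formal power series and their truncation.

module PowerSeries {c ℓ} (R : CommutativeRing c ℓ) where
  open CommutativeRing R
  open SetoidReasoning setoid
  open Solver commutativeSemiring

  Series : Set c
  Series = ℕ → Carrier

  constant : Carrier → Series
  constant x zero = x
  constant x (suc i) = 0#

  q : Series
  q zero = 0#
  q (suc i) = constant 1# i

  infixl 6 _⊕_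
  infixl 7 _⊛_

  -- The Cauchy product, computed by writing the left factor as f = f 0 + q (f ∘ suc).
  _⊕_ _⊛_ : Series → Series → Series
  (f ⊕ g) i = f i + g i
  (f ⊛ g) zero = f 0 * g 0
  (f ⊛ g) (suc i) = f 0 * g (suc i) + ((f ∘ suc) ⊛ g) i

  -- Coefficient `n` of a product involves only coefficients up to `n`, so the product respects
  -- equality up to a given degree.
  ⊛-cong-≤ : ∀ {f f′ g g′} n → (∀ i → i ≤ n → f i ≈ f′ i) → (∀ i → i ≤ n → g i ≈ g′ i) →
    (f ⊛ g) n ≈ (f′ ⊛ g′) n
  ⊛-cong-≤ zero f≈ g≈ = *-cong (f≈ 0 z≤n) (g≈ 0 z≤n)
  ⊛-cong-≤ (suc n) f≈ g≈ = +-cong (*-cong (f≈ 0 z≤n) (g≈ (suc n) ≤-refl))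
    (⊛-cong-≤ n (λ i i≤n → f≈ (suc i) (s≤s i≤n)) (λ i i≤n → g≈ i (≤-trans i≤n (n≤1+n n))))

  zero-⊛ : ∀ {f} g i → (∀ j → f j ≈ 0#) → (f ⊛ g) i ≈ 0#
  zero-⊛ g zero f≈0 = trans (*-congʳ (f≈0 0)) (zeroˡ _)
  zero-⊛ g (suc i) f≈0 = trans (+-cong (trans (*-congʳ (f≈0 0)) (zeroˡ _)) (zero-⊛ g i (f≈0 ∘ suc)))
    (+-identityˡ 0#)

  constant-⊛ : ∀ x f i → (constant x ⊛ f) i ≈ x * f i
  constant-⊛ x f zero = refl
  constant-⊛ x f (suc i) = trans (+-congˡ (zero-⊛ f i (λ _ → refl))) (+-identityʳ _)

  ⊛-distribˡ : ∀ f g h i → (f ⊛ (g ⊕ h)) i ≈ (f ⊛ g) i + (f ⊛ h) i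
  ⊛-distribˡ f g h zero = distribˡ _ _ _
  ⊛-distribˡ f g h (suc i) = trans (+-cong (distribˡ _ _ _) (⊛-distribˡ (f ∘ suc) g h i))
    (solve 4 (λ a b c d → a :+ b :+ (c :+ d) := a :+ c :+ (b :+ d)) refl _ _ _ _)

  ⊛-distribʳ : ∀ f g h i → ((g ⊕ h) ⊛ f) i ≈ (g ⊛ f) i + (h ⊛ f) i
  ⊛-distribʳ f g h zero = distribʳ _ _ _
  ⊛-distribʳ f g h (suc i) = trans (+-cong (distribʳ _ _ _) (⊛-distribʳ f (g ∘ suc) (h ∘ suc) i))
    (solve 4 (λ a b c d → a :+ b :+ (c :+ d) := a :+ c :+ (b :+ d)) refl _ _ _ _)

  ⊛-scaleˡ : ∀ x f g i → ((λ j → x * f j) ⊛ g) i ≈ x * (f ⊛ g) i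
  ⊛-scaleˡ x f g zero = *-assoc _ _ _
  ⊛-scaleˡ x f g (suc i) = trans (+-cong (*-assoc _ _ _) (⊛-scaleˡ x (f ∘ suc) g i)) (sym (distribˡ _ _ _))

  -- The recursion with the right factor split instead of the left; it turns commutativity into an
  -- induction on the index.
  ⊛-sucʳ : ∀ f g i → (f ⊛ g) (suc i) ≈ f (suc i) * g 0 + (f ⊛ (g ∘ suc)) i
  ⊛-sucʳ f g zero = +-comm _ _
  ⊛-sucʳ f g (suc i) = trans (+-congˡ (⊛-sucʳ (f ∘ suc) g i))
    (solve 3 (λ a b c → a :+ (b :+ c) := b :+ (a :+ c)) refl _ _ _)

  ⊛-comm : ∀ f g i → (f ⊛ g) i ≈ (g ⊛ f) i
  ⊛-comm f g zero = *-comm _ _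
  ⊛-comm f g (suc i) = trans (⊛-sucʳ f g i) (+-cong (*-comm _ _) (⊛-comm f (g ∘ suc) i))

  ⊛-assoc : ∀ f g h i → ((f ⊛ g) ⊛ h) i ≈ (f ⊛ (g ⊛ h)) i
  ⊛-assoc f g h zero = *-assoc _ _ _
  ⊛-assoc f g h (suc i) = begin
    f 0 * g 0 * h (suc i) + (((λ j → f 0 * g (suc j)) ⊕ ((f ∘ suc) ⊛ g)) ⊛ h) i
      ≈⟨ +-congˡ (⊛-distribʳ h (λ j → f 0 * g (suc j)) ((f ∘ suc) ⊛ g) i) ⟩
    f 0 * g 0 * h (suc i) + (((λ j → f 0 * g (suc j)) ⊛ h) i + (((f ∘ suc) ⊛ g) ⊛ h) i)
      ≈⟨ +-congˡ (+-cong (⊛-scaleˡ (f 0) (g ∘ suc) h i) (⊛-assoc (f ∘ suc) g h i)) ⟩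
    f 0 * g 0 * h (suc i) + (f 0 * ((g ∘ suc) ⊛ h) i + ((f ∘ suc) ⊛ (g ⊛ h)) i)
      ≈⟨ solve 5 (λ a b c d e → a :* b :* c :+ (a :* d :+ e) := a :* (b :* c :+ d) :+ e) refl _ _ _ _ _ ⟩
    f 0 * (g ⊛ h) (suc i) + ((f ∘ suc) ⊛ (g ⊛ h)) i ∎

  -- The quotient by q^(n+1), realised as a setoid: series are kept whole and equality ignores the
  -- coefficients beyond `n`. Powers of `q` above `n` are zero here, which supplies the vanishing
  -- hypotheses of the recurrence part.
  truncated : ℕ → CommutativeRing c ℓ
  truncated n = record
    { Carrier = Series
    ; _≈_ = λ f g → ∀ i → i ≤ n → f i ≈ g i
    ; _+_ = _⊕_
    ; _*_ = _⊛_
    ; -_ = λ f i → - f i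
    ; 0# = λ _ → 0#
    ; 1# = constant 1#
    ; isCommutativeRing = record
      { isRing = record
        { +-isAbelianGroup = record
          { isGroup = record
            { isMonoid = record
              { isSemigroup = record
                { isMagma = record
                  { isEquivalence = record
                    { refl = λ _ _ → refl
                    ; sym = λ f≈g i i≤n → sym (f≈g i i≤n)
                    ; trans = λ f≈g g≈h i i≤n → trans (f≈g i i≤n) (g≈h i i≤n)
                    }
                  ; ∙-cong = λ f≈ g≈ i i≤n → +-cong (f≈ i i≤n) (g≈ i i≤n)
                  }
                ; assoc = λ f g h i _ → +-assoc (f i) (g i) (h i)
                }
              ; identity = (λ f i _ → +-identityˡ (f i)) , (λ f i _ → +-identityʳ (f i))
              }
            ; inverse = (λ f i _ → -‿inverseˡ (f i)) , (λ f i _ → -‿inverseʳ (f i))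
            ; ⁻¹-cong = λ f≈ i i≤n → -‿cong (f≈ i i≤n)
            }
          ; comm = λ f g i _ → +-comm (f i) (g i)
          }
        ; *-cong = λ f≈ g≈ i i≤n → ⊛-cong-≤ i (λ j j≤i → f≈ j (≤-trans j≤i i≤n))
                                              (λ j j≤i → g≈ j (≤-trans j≤i i≤n))
        ; *-assoc = λ f g h i _ → ⊛-assoc f g h i
        ; *-identity = (λ f i _ → one-⊛ f i)
                     , (λ f i _ → trans (⊛-comm f (constant 1#) i) (one-⊛ f i))
        ; distrib = (λ f g h i _ → ⊛-distribˡ f g h i) , (λ f g h i _ → ⊛-distribʳ f g h i)
        }
      ; *-comm = λ f g i _ → ⊛-comm f g i
      }
    }
    where
    one-⊛ : ∀ f i → (constant 1# ⊛ f) i ≈ f i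
    one-⊛ f i = trans (constant-⊛ 1# f i) (*-identityˡ (f i))

  q-⊛-suc : ∀ f i → (q ⊛ f) (suc i) ≈ f i
  q-⊛-suc f i = trans (+-cong (zeroˡ _) (trans (constant-⊛ 1# f i) (*-identityˡ (f i)))) (+-identityˡ (f i))

  module _ (n : ℕ) where
    private
      q^ : ℕ → Series
      q^ = pow (truncated n) q

    q^-⊛-suc-zero : ∀ k f → (q^ (suc k) ⊛ f) 0 ≈ 0#
    q^-⊛-suc-zero k f = trans (⊛-assoc q (q^ k) f 0) (zeroˡ _)

    q^-⊛-suc-suc : ∀ k f i → (q^ (suc k) ⊛ f) (suc i) ≈ (q^ k ⊛ f) i
    q^-⊛-suc-suc k f i = trans (⊛-assoc q (q^ k) f (suc i)) (q-⊛-suc (q^ k ⊛ f) i)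

    q^-⊛-< : ∀ {i k} f → i < k → (q^ k ⊛ f) i ≈ 0#
    q^-⊛-< f (s≤s {zero} {k} i<k) = q^-⊛-suc-zero k f
    q^-⊛-< f (s≤s {suc i} {k} i<k) = trans (q^-⊛-suc-suc k f i) (q^-⊛-< f i<k)

-- Partitions with bounded parts, and the effect of a new largest part on the chains.

parts : ℕ → List ℕ
parts M = map suc (downFrom M)

partitions≤ : ℕ → List (List ℕ)
partitions≤ M = sublists (parts M)

All-sublists : ∀ {P : ℕ → Set} {xs} → All P xs → All (All P) (sublists xs)
All-sublists [] = [] ∷ []
All-sublists (px ∷ pxs) =
  AllP.++⁺ (AllP.map⁺ (All.map (px ∷_) (All-sublists pxs))) (All-sublists pxs)

parts-≤ : ∀ M → All (_≤ M) (parts M)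
parts-≤ zero = []
parts-≤ (suc M) = ≤-refl ∷ All.map (λ x≤M → ≤-trans x≤M (n≤1+n M)) (parts-≤ M)

partitions≤-bounded : ∀ M → All (All (_≤ M)) (partitions≤ M)
partitions≤-bounded M = All-sublists (parts-≤ M)

-- `chains` compares a new part with the head of the first chain; this identifies that head with the
-- largest part `y`.
chains-head : ∀ y ys → ∃₂ λ d ds → chains (y ∷ ys) ≡ (y ∷ d) ∷ ds
chains-head y ys with chains ys
... | [] = [] , [] , ≡.refl
... | [] ∷ ds = [] , [] ∷ ds , ≡.refl
... | (x ∷ d) ∷ ds with (x +ℕ 4) ≡ᵇ y
...   | true = x ∷ d , ds , ≡.refl
...   | false = [] , (x ∷ d) ∷ ds , ≡.refl

leastPart-∷ : ∀ x y d → leastPart (x ∷ y ∷ d) ≡ leastPart (y ∷ d)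
leastPart-∷ x y d with last (y ∷ d)
... | just _ = ≡.refl
... | nothing = ≡.refl

-- The part `x` joins the first chain at its top, so the least part that decides whether the chain
-- counts is unchanged.
N-extend : ∀ k x y ys → (y +ℕ 4 ≡ᵇ x) ≡ true → N k (x ∷ y ∷ ys) ≡ N k (y ∷ ys)
N-extend k x y ys y+4≡x with d , ds , eq ← chains-head y ys rewrite eq | y+4≡x =
  count-≡ (x ∷ y ∷ d) (y ∷ d) (leastPart-∷ x y d)
  where
  count-≡ : ∀ d d′ {ds} → leastPart d ≡ leastPart d′ →
    length (filter (λ e → T? (k ≤ᵇ leastPart e)) (d ∷ ds)) ≡
    length (filter (λ e → T? (k ≤ᵇ leastPart e)) (d′ ∷ ds))
  count-≡ d d′ eq with leastPart d | leastPart d′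
  count-≡ d d′ ≡.refl | l | .l with k ≤ᵇ l
  ... | true = ≡.refl
  ... | false = ≡.refl

N-new : ∀ k x y ys → (y +ℕ 4 ≡ᵇ x) ≡ false → (k ≤ᵇ x) ≡ true → N k (x ∷ y ∷ ys) ≡ suc (N k (y ∷ ys))
N-new k x y ys y+4≢x k≤x with d , ds , eq ← chains-head y ys rewrite eq | y+4≢x | k≤x = ≡.refl

-- Weighted generating functions of partitions with bounded parts.

module GeneratingFunctions {c ℓ} (R : CommutativeRing c ℓ) (n : ℕ) where
  open CommutativeRing R
  open PowerSeries R
  open SetoidReasoning setoid
  private
    module S = CommutativeRing (truncated n)
    module SS = Solver S.commutativeSemiring

  ∑ : {A : Set} → List A → (A → Carrier) → Carrier
  ∑ = Σ-list R

  module _ {A : Set} where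
    ∑-++ : ∀ xs ys (f : A → Carrier) → ∑ (xs ++ ys) f ≈ ∑ xs f + ∑ ys f
    ∑-++ [] ys f = sym (+-identityˡ _)
    ∑-++ (x ∷ xs) ys f = trans (+-congˡ (∑-++ xs ys f)) (sym (+-assoc _ _ _))

    ∑-cong : ∀ {xs} {f g : A → Carrier} → All (λ x → f x ≈ g x) xs → ∑ xs f ≈ ∑ xs g
    ∑-cong [] = refl
    ∑-cong (fx≈gx ∷ f≈g) = +-cong fx≈gx (∑-cong f≈g)

    ∑-0 : ∀ xs → ∑ {A} xs (λ _ → 0#) ≈ 0#
    ∑-0 [] = refl
    ∑-0 (x ∷ xs) = trans (+-identityˡ _) (∑-0 xs)

    ∑-* : ∀ a xs (f : A → Carrier) → ∑ xs (λ x → a * f x) ≈ a * ∑ xs f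
    ∑-* a [] f = sym (zeroʳ a)
    ∑-* a (x ∷ xs) f = trans (+-congˡ (∑-* a xs f)) (sym (distribˡ _ _ _))

    ∑-map : ∀ {B : Set} (h : B → A) xs f → ∑ (map h xs) f ≈ ∑ xs (f ∘ h)
    ∑-map h [] f = refl
    ∑-map h (x ∷ xs) f = +-congˡ (∑-map h xs f)

    ∑-filter : ∀ (b : A → Bool) xs f → ∑ (filter (λ x → T? (b x)) xs) f ≈ ∑ xs (λ x → if b x then f x else 0#)
    ∑-filter b [] f = refl
    ∑-filter b (x ∷ xs) f with b x
    ... | true = +-congˡ (∑-filter b xs f)
    ... | false = trans (∑-filter b xs f) (sym (+-identityˡ _))

  gf : (List ℕ → Carrier) → List (List ℕ) → Series
  gf w L i = ∑ L (λ p → if σ p ≡ᵇ i then w p else 0#)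

  gf≤ : (List ℕ → Carrier) → ℕ → Series
  gf≤ w M = gf w (partitions≤ M)

  private
    q^ : ℕ → Series
    q^ = pow (truncated n) q

  gf-scale : ∀ a {w w′ L} → All (λ p → w′ p ≈ a * w p) L → gf w′ L S.≈ constant a ⊛ gf w L
  gf-scale a {w} {w′} {L} w′≈aw i _ = begin
    gf w′ L i ≈⟨ ∑-cong (All.map (λ {p} → scale p) w′≈aw) ⟩
    ∑ L (λ p → a * (if σ p ≡ᵇ i then w p else 0#)) ≈⟨ ∑-* a L _ ⟩
    a * gf w L i ≈⟨ constant-⊛ a _ i ⟨
    (constant a ⊛ gf w L) i ∎
    where
    scale : ∀ p → w′ p ≈ a * w p →
      (if σ p ≡ᵇ i then w′ p else 0#) ≈ a * (if σ p ≡ᵇ i then w p else 0#)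
    scale p w′p≈ with σ p ≡ᵇ i
    ... | true = w′p≈
    ... | false = sym (zeroʳ a)

  gf-zero : ∀ {w} L → (∀ p → w p ≈ 0#) → gf w L S.≈ S.0#
  gf-zero {w} L w≈0 i _ = begin
    gf w L i ≈⟨ ∑-cong (All.universal (λ p → vanish (σ p ≡ᵇ i) (w≈0 p)) L) ⟩
    ∑ L (λ _ → 0#) ≈⟨ ∑-0 L ⟩
    0# ∎
    where
    vanish : ∀ b {x} → x ≈ 0# → (if b then x else 0#) ≈ 0#
    vanish true x≈0 = x≈0
    vanish false _ = refl

  gf-shift : ∀ x w L i → ∑ L (λ p → if x +ℕ σ p ≡ᵇ i then w p else 0#) ≈ (q^ x ⊛ gf w L) i
  gf-shift zero w L i = sym (trans (constant-⊛ 1# (gf w L) i) (*-identityˡ _))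
  gf-shift (suc x) w L zero = trans (∑-0 L) (sym (q^-⊛-suc-zero n x (gf w L)))
  gf-shift (suc x) w L (suc i) = trans (gf-shift x w L i) (sym (q^-⊛-suc-suc n x (gf w L) i))

  gf≤-suc : ∀ w M → gf≤ w (suc M) S.≈ q^ (suc M) ⊛ gf≤ (w ∘ (suc M ∷_)) M ⊕ gf≤ w M
  gf≤-suc w M i _ = begin
    gf≤ w (suc M) i ≈⟨ ∑-++ (map (suc M ∷_) (partitions≤ M)) (partitions≤ M) _ ⟩
    ∑ (map (suc M ∷_) (partitions≤ M)) _ + gf≤ w M i
      ≈⟨ +-congʳ (trans (∑-map (suc M ∷_) (partitions≤ M) _) (gf-shift (suc M) _ (partitions≤ M) i)) ⟩
    (q^ (suc M) ⊛ gf≤ (w ∘ (suc M ∷_)) M) i + gf≤ w M i ∎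

  gf≤-skip : ∀ {w} M → (∀ p → w (suc M ∷ p) ≈ 0#) → gf≤ w (suc M) S.≈ gf≤ w M
  gf≤-skip {w} M w≈0 = S.trans (gf≤-suc w M) (S.trans
    (S.+-congʳ (S.trans (S.*-congˡ (gf-zero (partitions≤ M) w≈0)) (S.zeroʳ (q^ (suc M)))))
    (S.+-identityˡ (gf≤ w M)))

  gf≤-scale : ∀ a {w} M → (∀ p → w (suc M ∷ p) ≈ a * w p) →
    gf≤ w (suc M) S.≈ gf≤ w M ⊛ (S.1# ⊕ constant a ⊛ q^ (suc M))
  gf≤-scale a {w} M wx≈aw = S.trans (gf≤-suc w M) (S.trans
    (S.+-congʳ (S.*-congˡ (gf-scale a (All.universal wx≈aw (partitions≤ M)))))
    (SS.solve 3 (λ x a g → x SS.:* (a SS.:* g) SS.:+ g SS.:= g SS.:* (SS.con 1 SS.:+ a SS.:* x))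
      S.refl (q^ (suc M)) (constant a) (gf≤ w M)))

  -- A part larger than `M` brings a factor q^(M+1) or higher, which does not reach coefficient `i`
  -- when `i ≤ M`.
  gf≤-stable : ∀ w {i} j M → i ≤ n → i ≤ M → gf≤ w (j +ℕ M) i ≈ gf≤ w M i
  gf≤-stable w zero M i≤n i≤M = refl
  gf≤-stable w {i} (suc j) M i≤n i≤M = begin
    gf≤ w (suc (j +ℕ M)) i ≈⟨ gf≤-suc w (j +ℕ M) i i≤n ⟩
    (q^ (suc (j +ℕ M)) ⊛ gf≤ _ (j +ℕ M)) i + gf≤ w (j +ℕ M) i
      ≈⟨ +-congʳ (q^-⊛-< n _ (s≤s (≤-trans i≤M (m≤n+m M j)))) ⟩
    0# + gf≤ w (j +ℕ M) i ≈⟨ +-identityˡ _ ⟩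
    gf≤ w (j +ℕ M) i ≈⟨ gf≤-stable w j M i≤n i≤M ⟩
    gf≤ w M i ∎

  -- Membership in a class of partitions becomes a zero weight outside it, so both sides of the
  -- theorem are sums over the same list.
  gf-coefficient : ∀ b f L i →
    ∑ (filter (λ p → T? (b p)) (filter (λ p → T? (σ p ≡ᵇ i)) L)) f ≈ gf (λ p → if b p then f p else 0#) L i
  gf-coefficient b f L i = trans (∑-filter b (filter (λ p → T? (σ p ≡ᵇ i)) L) f) (∑-filter (λ p → σ p ≡ᵇ i) L _)

-- The two weights and how they change when a part is prepended.

+4≤ : ∀ y {x} → y +ℕ 4 ≤ x → ((y +ℕ 4) ≤ᵇ x) ≡ true
+4≤ y {x} = dec-true (y +ℕ 4 ≤? x)

+4≰ : ∀ y {x} → x < y +ℕ 4 → ((y +ℕ 4) ≤ᵇ x) ≡ false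
+4≰ y {x} x<y+4 = dec-false (y +ℕ 4 ≤? x) (<⇒≱ x<y+4)

+4< : ∀ {y k} → y ≤ k → y +ℕ 4 < 5 +ℕ k
+4< {y} {k} y≤k = ≡.subst (_< 5 +ℕ k) (+ℕ-comm 4 y) (s≤s (s≤s (s≤s (s≤s (s≤s y≤k)))))

<+4 : ∀ {x y} → x < y → 4 +ℕ x < y +ℕ 4
<+4 {x} {y} x<y = ≡.subst (4 +ℕ x <_) (+ℕ-comm 4 y) (s≤s (s≤s (s≤s (s≤s x<y))))

module Weights {c ℓ} (R : CommutativeRing c ℓ) (z : CommutativeRing.Carrier R) (n : ℕ) where
  open CommutativeRing R
  open PowerSeries R
  open GeneratingFunctions R n
  private
    module S = CommutativeRing (truncated n)
    module RS = Solver commutativeSemiring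
    module SS = Solver S.commutativeSemiring

  open Recurrence (truncated n) q

  a : Carrier
  a = - pow R z 2

  oddWeight mod4Weight : List ℕ → Carrier
  oddWeight p = if isO4 p then pow R z (ν p) * pow R (1# - pow R z 2) (N 5 p) else 0#
  mod4Weight p = if isD24 p then pow R z (νmod p 1 2) * pow R a (νmod p 0 2) else 0#

  mod4Weight-2 : ∀ x p → x % 4 ≡ 2 → mod4Weight (x ∷ p) ≈ 0#
  mod4Weight-2 x p eq rewrite eq = refl

  mod4Weight-odd : ∀ x p → (x % 4 ≡ᵇ 2) ≡ false → x % 2 ≡ 1 → mod4Weight (x ∷ p) ≈ z * mod4Weight p
  mod4Weight-odd x p eq₄ eq₂ rewrite eq₄ | eq₂ with isD24 p
  ... | true = *-assoc _ _ _
  ... | false = sym (zeroʳ z)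

  mod4Weight-even : ∀ x p → (x % 4 ≡ᵇ 2) ≡ false → x % 2 ≡ 0 → mod4Weight (x ∷ p) ≈ a * mod4Weight p
  mod4Weight-even x p eq₄ eq₂ rewrite eq₄ | eq₂ with isD24 p
  ... | true = RS.solve 3 (λ x y a → x RS.:* (a RS.:* y) RS.:= a RS.:* (x RS.:* y)) refl _ _ a
  ... | false = sym (zeroʳ a)

  oddWeight-even : ∀ x p → x % 2 ≡ 0 → oddWeight (x ∷ p) ≈ 0#
  oddWeight-even x [] eq rewrite eq = refl
  oddWeight-even x (y ∷ p) eq rewrite eq = refl

  oddWeight-close : ∀ x y p → x < y +ℕ 4 → oddWeight (x ∷ y ∷ p) ≈ 0#
  oddWeight-close x y p x<y+4 rewrite +4≰ y x<y+4 with isOdd x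
  ... | true = refl
  ... | false = refl

  oddWeight-extend : ∀ x y p → x % 2 ≡ 1 → y +ℕ 4 ≡ x → oddWeight (x ∷ y ∷ p) ≈ z * oddWeight (y ∷ p)
  oddWeight-extend x y p odd ≡.refl
    rewrite odd | +4≤ y ≤-refl | N-extend 5 (y +ℕ 4) y p (dec-true (y +ℕ 4 ≟ y +ℕ 4) ≡.refl)
    with isO4 (y ∷ p)
  ... | true = *-assoc _ _ _
  ... | false = sym (zeroʳ z)

  -- All other parts are more than 4 below 5 + k, so this part is a chain by itself. Its least part
  -- is at least 5, so it counts in `N 5` and brings the factor 1 + a = 1 - z².
  oddWeight-new : ∀ k p → (5 +ℕ k) % 2 ≡ 1 → All (_≤ k) p →
    oddWeight (5 +ℕ k ∷ p) ≈ z * (1# + a) * oddWeight p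
  oddWeight-new k [] odd _ rewrite odd =
    RS.solve 2 (λ z b → z RS.:* RS.con 1 RS.:* (b RS.:* RS.con 1) RS.:= z RS.:* b RS.:* (RS.con 1 RS.:* RS.con 1))
      refl z (1# + a)
  oddWeight-new k (y ∷ p) odd (y≤k ∷ _)
    rewrite odd | +4≤ y (<⇒≤ (+4< y≤k))
      | N-new 5 (5 +ℕ k) y p (dec-false (y +ℕ 4 ≟ 5 +ℕ k) (<⇒≢ (+4< y≤k))) ≡.refl
    with isO4 (y ∷ p)
  ... | true = RS.solve 4 (λ z b u v → z RS.:* u RS.:* (b RS.:* v) RS.:= z RS.:* b RS.:* (u RS.:* v))
                 refl z (1# + a) _ _
  ... | false = sym (zeroʳ _)

  constant-* : ∀ x y → constant (x * y) S.≈ constant x ⊛ constant y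
  constant-* x y zero _ = refl
  constant-* x y (suc i) _ = sym (trans (constant-⊛ x (constant y) (suc i)) (zeroʳ x))

  Z A : Series
  Z = constant z
  A = constant a

  Z²+A≈0 : Z ⊛ Z ⊕ A S.≈ S.0#
  Z²+A≈0 zero _ = trans (+-congʳ (sym (*-congˡ (*-identityʳ z)))) (-‿inverseʳ (pow R z 2))
  Z²+A≈0 (suc i) _ = trans (+-identityʳ _) (trans (constant-⊛ z Z (suc i)) (zeroʳ z))

  -- The generating function of 𝒪₄ satisfies the recurrence.

  oddGF : ℕ → Series
  oddGF = gf≤ oddWeight

  oddGF-0 : oddGF 0 S.≈ S.1#
  oddGF-0 zero _ = trans (+-identityʳ _) (*-identityˡ 1#)
  oddGF-0 (suc i) _ = +-identityʳ 0#

  oddGF-even : ∀ m → oddGF (2 +ℕ m *ℕ 2) S.≈ oddGF (1 +ℕ m *ℕ 2)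
  oddGF-even m = gf≤-skip (1 +ℕ m *ℕ 2) (λ p → oddWeight-even _ p ([m+kn]%n≡m%n 2 m 2))

  skip₃ : ∀ w k → (∀ y p → k < y → w (y ∷ p) ≈ 0#) → gf≤ w (3 +ℕ k) S.≈ gf≤ w k
  skip₃ w k w≈0 = S.trans (gf≤-skip (2 +ℕ k) λ p → w≈0 _ p (m≤n+m (suc k) 2))
    (S.trans (gf≤-skip (1 +ℕ k) λ p → w≈0 _ p (m≤n+m (suc k) 1)) (gf≤-skip k λ p → w≈0 _ p ≤-refl))

  -- Below the largest part 5 + k, the parts 2 + k to 4 + k are too close. If 1 + k comes next, the
  -- chain is extended with weight `z`; otherwise the weight is `z (1 + a)`. The `z` terms together
  -- run over all partitions with parts at most 1 + k, and the `a` term over those with parts at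
  -- most k.
  oddGF-head : ∀ m → let k = m *ℕ 2 in
    gf≤ (oddWeight ∘ (5 +ℕ k ∷_)) (4 +ℕ k) S.≈ Z ⊛ (oddGF (2 +ℕ k) ⊕ A ⊛ oddGF k)
  oddGF-head m = begin
    gf≤ w (4 +ℕ k) ≈⟨ skip₃ w (1 +ℕ k) (λ y p k<y → oddWeight-close _ y p (<+4 k<y)) ⟩
    gf≤ w (1 +ℕ k) ≈⟨ gf≤-suc w k ⟩
    q^ (1 +ℕ k) ⊛ gf≤ (w ∘ (1 +ℕ k ∷_)) k ⊕ gf≤ w k
      ≈⟨ S.+-cong (S.*-congˡ (gf-scale z (All.universal (λ p → oddWeight-extend _ _ p odd (+ℕ-comm (1 +ℕ k) 4)) (partitions≤ k))))
                  (gf-scale (z * (1# + a)) (All.map (λ {p} → oddWeight-new k p odd) (partitions≤-bounded k))) ⟩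
    q^ (1 +ℕ k) ⊛ (Z ⊛ g) ⊕ constant (z * (1# + a)) ⊛ oddGF k
      ≈⟨ S.+-congˡ (S.*-congʳ (S.trans (constant-* z (1# + a)) (S.*-congˡ constant-1+a))) ⟩
    q^ (1 +ℕ k) ⊛ (Z ⊛ g) ⊕ (Z ⊛ (S.1# ⊕ A)) ⊛ oddGF k
      ≈⟨ SS.solve 5 (λ x z a g h → x SS.:* (z SS.:* g) SS.:+ z SS.:* (SS.con 1 SS.:+ a) SS.:* h SS.:=
           z SS.:* (x SS.:* g SS.:+ h SS.:+ a SS.:* h)) S.refl (q^ (1 +ℕ k)) Z A g (oddGF k) ⟩
    Z ⊛ (q^ (1 +ℕ k) ⊛ g ⊕ oddGF k ⊕ A ⊛ oddGF k)
      ≈⟨ S.*-congˡ (S.+-congʳ (S.trans (oddGF-even m) (gf≤-suc oddWeight k))) ⟨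
    Z ⊛ (oddGF (2 +ℕ k) ⊕ A ⊛ oddGF k) ∎
    where
    open SetoidReasoning S.setoid
    k = m *ℕ 2
    w = oddWeight ∘ (5 +ℕ k ∷_)
    g = gf≤ (oddWeight ∘ (1 +ℕ k ∷_)) k
    constant-1+a : constant (1# + a) S.≈ S.1# ⊕ A
    constant-1+a zero _ = refl
    constant-1+a (suc i) _ = sym (+-identityʳ 0#)
    odd : (5 +ℕ k) % 2 ≡ 1
    odd = [m+kn]%n≡m%n 5 m 2

  singletonGF : ∀ x → oddWeight (x ∷ []) ≈ z * 1# * 1# → gf≤ (oddWeight ∘ (x ∷_)) 0 S.≈ Z
  singletonGF x w≈ = S.trans (gf-scale z {oddWeight} {oddWeight ∘ (x ∷_)} {[] ∷ []} (trans w≈ (*-assoc z 1# 1#) ∷ []))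
    (S.trans (S.*-congˡ oddGF-0) (S.*-identityʳ Z))

  -- The largest parts 1 and 3 need separate cases, as they open chains that `N 5` does not count;
  -- from 5 on, `oddGF-head` gives the recurrence.
  oddGF≈gapSeq : ∀ m → oddGF (m *ℕ 2) S.≈ gapSeq Z A (1 +ℕ m)
  oddGF≈gapSeq 0 = oddGF-0
  oddGF≈gapSeq 1 = begin
    oddGF 2 ≈⟨ oddGF-even 0 ⟩
    oddGF 1 ≈⟨ gf≤-suc oddWeight 0 ⟩
    q^ 1 ⊛ gf≤ (oddWeight ∘ (1 ∷_)) 0 ⊕ oddGF 0 ≈⟨ S.+-cong (S.*-congˡ (singletonGF 1 refl)) oddGF-0 ⟩
    q^ 1 ⊛ Z ⊕ S.1# ≈⟨ SS.solve 2 (λ x z → x SS.:* z SS.:+ SS.con 1 SS.:= SS.con 1 SS.:+ z SS.:* x) S.refl (q^ 1) Z ⟩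
    S.1# ⊕ Z ⊛ q^ 1 ∎
    where open SetoidReasoning S.setoid
  oddGF≈gapSeq 2 = begin
    oddGF 4 ≈⟨ oddGF-even 1 ⟩
    oddGF 3 ≈⟨ gf≤-suc oddWeight 2 ⟩
    q^ 3 ⊛ gf≤ w 2 ⊕ oddGF 2
      ≈⟨ S.+-congʳ (S.*-congˡ (S.trans (gf≤-skip {w} 1 λ p → oddWeight-close 3 2 p (m≤n+m 4 2))
           (gf≤-skip {w} 0 λ p → oddWeight-close 3 1 p (m≤n+m 4 1)))) ⟩
    q^ 3 ⊛ gf≤ w 0 ⊕ oddGF 2 ≈⟨ S.+-cong (S.*-congˡ (singletonGF 3 refl)) (oddGF≈gapSeq 1) ⟩
    q^ 3 ⊛ Z ⊕ gapSeq Z A 2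
      -- The `con 0` is the initial value `gapSeq Z A 0`.
      ≈⟨ SS.solve 4 (λ x z a e → x SS.:* z SS.:+ e SS.:= e SS.:+ z SS.:* x SS.:* (SS.con 1 SS.:+ a SS.:* SS.con 0))
           S.refl (q^ 3) Z A (gapSeq Z A 2) ⟩
    gapSeq Z A 3 ∎
    where
    open SetoidReasoning S.setoid
    w = oddWeight ∘ (3 ∷_)
  oddGF≈gapSeq (suc (suc (suc m))) = begin
    oddGF (6 +ℕ k) ≈⟨ oddGF-even (2 +ℕ m) ⟩
    oddGF (5 +ℕ k) ≈⟨ gf≤-suc oddWeight (4 +ℕ k) ⟩
    q^ (5 +ℕ k) ⊛ gf≤ (oddWeight ∘ (5 +ℕ k ∷_)) (4 +ℕ k) ⊕ oddGF (4 +ℕ k)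
      ≈⟨ S.+-cong (S.*-congˡ (oddGF-head m)) (oddGF≈gapSeq (suc (suc m))) ⟩
    q^ (5 +ℕ k) ⊛ (Z ⊛ (oddGF (2 +ℕ k) ⊕ A ⊛ oddGF k)) ⊕ e (3 +ℕ m)
      ≈⟨ S.+-congʳ (S.*-congˡ (S.*-congˡ (S.+-cong (oddGF≈gapSeq (suc m)) (S.*-congˡ (oddGF≈gapSeq m))))) ⟩
    q^ (5 +ℕ k) ⊛ (Z ⊛ (e (2 +ℕ m) ⊕ A ⊛ e (1 +ℕ m))) ⊕ e (3 +ℕ m)
      ≈⟨ SS.solve 4 (λ x z u v → x SS.:* (z SS.:* u) SS.:+ v SS.:= v SS.:+ z SS.:* x SS.:* u)
           S.refl (q^ (5 +ℕ k)) Z (e (2 +ℕ m) ⊕ A ⊛ e (1 +ℕ m)) (e (3 +ℕ m)) ⟩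
    e (4 +ℕ m) ∎
    where
    open SetoidReasoning S.setoid
    k = m *ℕ 2
    e = gapSeq Z A

  -- The generating function of 𝒟₂,₄ is a product.

  mod4GF : ℕ → Series
  mod4GF = gf≤ mod4Weight

  mod4GF-0 : mod4GF 0 S.≈ S.1#
  mod4GF-0 zero _ = trans (+-identityʳ _) (*-identityˡ 1#)
  mod4GF-0 (suc i) _ = +-identityʳ 0#

  -- Each part is chosen independently, so every block of four consecutive sizes contributes two odd
  -- factors, one factor for the multiple of 4, and none for the residue 2.
  mod4GF≈product : ∀ m → mod4GF (m *ℕ 4) S.≈ oddProduct Z (m *ℕ 2) ⊛ quadProduct A m
  mod4GF≈product zero = S.trans mod4GF-0 (S.sym (S.*-identityˡ S.1#))
  mod4GF≈product (suc m) = begin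
    mod4GF (4 +ℕ k)
      ≈⟨ gf≤-scale a (3 +ℕ k) (λ p → mod4Weight-even (4 +ℕ k) p (≡.cong (_≡ᵇ 2) (%4 4)) (%2 4)) ⟩
    mod4GF (3 +ℕ k) ⊛ X₄
      ≈⟨ S.*-congʳ (gf≤-scale z (2 +ℕ k) (λ p → mod4Weight-odd (3 +ℕ k) p (≡.cong (_≡ᵇ 2) (%4 3)) (%2 3))) ⟩
    mod4GF (2 +ℕ k) ⊛ X₃ ⊛ X₄
      ≈⟨ S.*-congʳ (S.*-congʳ (gf≤-skip (1 +ℕ k) (λ p → mod4Weight-2 (2 +ℕ k) p (%4 2)))) ⟩
    mod4GF (1 +ℕ k) ⊛ X₃ ⊛ X₄
      ≈⟨ S.*-congʳ (S.*-congʳ (gf≤-scale z k (λ p → mod4Weight-odd (1 +ℕ k) p (≡.cong (_≡ᵇ 2) (%4 1)) (%2 1)))) ⟩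
    mod4GF k ⊛ X₁ ⊛ X₃ ⊛ X₄ ≈⟨ S.*-congʳ (S.*-congʳ (S.*-congʳ (mod4GF≈product m))) ⟩
    D ⊛ C ⊛ X₁ ⊛ X₃ ⊛ X₄
      ≈⟨ SS.solve 5 (λ d c x y u → d SS.:* c SS.:* x SS.:* y SS.:* u SS.:= d SS.:* x SS.:* y SS.:* (c SS.:* u))
           S.refl D C X₁ X₃ X₄ ⟩
    -- The exponents in `oddProduct` have the form (m · 2) · 2, those coming from the parts the form
    -- m · 4.
    D ⊛ X₁ ⊛ X₃ ⊛ (C ⊛ X₄) ≡⟨ ≡.cong (λ j → D ⊛ (S.1# ⊕ Z ⊛ q^ (1 +ℕ j)) ⊛ (S.1# ⊕ Z ⊛ q^ (3 +ℕ j)) ⊛ (C ⊛ X₄))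
                                (*ℕ-assoc m 2 2) ⟨
    oddProduct Z (2 +ℕ m *ℕ 2) ⊛ (C ⊛ X₄) ∎
    where
    open SetoidReasoning S.setoid
    k = m *ℕ 4
    D C X₁ X₃ X₄ : Series
    D = oddProduct Z (m *ℕ 2)
    C = quadProduct A m
    X₁ = S.1# ⊕ Z ⊛ q^ (1 +ℕ k)
    X₃ = S.1# ⊕ Z ⊛ q^ (3 +ℕ k)
    X₄ = S.1# ⊕ A ⊛ q^ (4 +ℕ k)
    %4 : ∀ r → (r +ℕ k) % 4 ≡ r % 4
    %4 r = [m+kn]%n≡m%n r m 4
    %2 : ∀ r → (r +ℕ k) % 2 ≡ r % 2
    %2 r = ≡.trans (≡.cong (λ j → (r +ℕ j) % 2) (≡.sym (*ℕ-assoc m 2 2))) ([m+kn]%n≡m%n r (m *ℕ 2) 2)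

  -- Comparison of the two generating functions up to qⁿ.

  ⊛q^≈0 : ∀ f {k} → n < k → f ⊛ q^ k S.≈ S.0#
  ⊛q^≈0 f {k} n<k i i≤n = trans (⊛-comm f (q^ k) i) (q^-⊛-< n f (≤-trans (s≤s i≤n) n<k))

  oddGF≈mod4GF : oddGF (suc n *ℕ 4) S.≈ mod4GF (suc n *ℕ 4)
  oddGF≈mod4GF = begin
    oddGF (suc n *ℕ 4) ≡⟨ ≡.cong (λ j → oddGF (4 +ℕ j)) (*ℕ-assoc n 2 2) ⟨
    oddGF ((suc n *ℕ 2) *ℕ 2) ≈⟨ oddGF≈gapSeq (suc n *ℕ 2) ⟩
    gapSeq Z A (2 +ℕ (1 +ℕ n *ℕ 2))
      -- The power of `q` that has to vanish is q^(4n+3), and 4n + 3 exceeds n.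
      ≈⟨ gapSeq≈product (1 +ℕ n *ℕ 2) Z A Z²+A≈0 (⊛q^≈0 Z
           (s≤s (≤-trans (m≤m*n n 2) (≤-trans (n≤1+n _) (m≤m*n _ 2))))) ⟩
    oddProduct Z (suc n *ℕ 2) ⊛ quadProduct A (suc n *ℕ 2)
      ≡⟨ ≡.cong (λ j → oddProduct Z (suc n *ℕ 2) ⊛ quadProduct A j) suc-n*2 ⟩
    oddProduct Z (suc n *ℕ 2) ⊛ quadProduct A (suc n +ℕ suc n)
      -- The recurrence gives 2n + 2 quadratic factors, the parts give only n + 1; each surplus
      -- factor is 1 modulo q^(n+1).
      ≈⟨ S.*-congˡ (quadProduct-stable A (suc n) (suc n) (λ i → ⊛q^≈0 A (≤-trans (m≤n+m (suc n) (suc i)) (m≤m*n _ 4)))) ⟩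
    oddProduct Z (suc n *ℕ 2) ⊛ quadProduct A (suc n) ≈⟨ mod4GF≈product (suc n) ⟨
    mod4GF (suc n *ℕ 4) ∎
    where
    open SetoidReasoning S.setoid
    suc-n*2 : suc n *ℕ 2 ≡ suc n +ℕ suc n
    suc-n*2 = ≡.trans (*ℕ-comm (suc n) 2) (≡.cong (suc n +ℕ_) (+ℕ-identityʳ (suc n)))

theorem1 : {c ℓ : Level} (R : CommutativeRing c ℓ) (z : CommutativeRing.Carrier R) (n : ℕ) →
    CommutativeRing._≈_ R
    (Σ-list R (filter (λ p → T? (isO4 p)) (distinctPartitions n))
    (λ p → CommutativeRing._*_ R (pow R z (ν p))
    (pow R (CommutativeRing._-_ R (CommutativeRing.1# R) (pow R z 2)) (N 5 p))))
    (Σ-list R (filter (λ p → T? (isD24 p)) (distinctPartitions n))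
    (λ p → CommutativeRing._*_ R (pow R z (νmod p 1 2))
    (pow R (CommutativeRing.-_ R (pow R z 2)) (νmod p 0 2))))
theorem1 R z n = begin
  _ ≈⟨ gf-coefficient isO4 _ (partitions≤ n) n ⟩
  oddGF n n ≈⟨ stable oddWeight ⟨
  oddGF M n ≈⟨ oddGF≈mod4GF n ≤-refl ⟩
  mod4GF M n ≈⟨ stable mod4Weight ⟩
  mod4GF n n ≈⟨ gf-coefficient isD24 _ (partitions≤ n) n ⟨
  _ ∎
  where
  open CommutativeRing R
  open GeneratingFunctions R n
  open Weights R z n
  open SetoidReasoning setoid
  -- A multiple of 4, so that whole blocks of parts are used, and at least `n`, so that the added
  -- parts do not affect coefficient `n`.
  M = suc n *ℕ 4
  stable : ∀ w → gf≤ w M n ≈ gf≤ w n n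
  stable w = ≡.subst (λ j → gf≤ w j n ≈ gf≤ w n n)
    (m∸n+n≡m (≤-trans (n≤1+n n) (m≤m*n (suc n) 4))) (gf≤-stable w (M ∸ n) n ≤-refl ≤-refl)
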